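{- Let $m\ge2$ and let $\mathcal{P}^{OC}_m$ be the set of partial matchings $\pi$ of $[m]$ (set partitions of $[m]$ with all blocks of size at most $2$) having at least one arc, such that every opener of $\pi$ is smaller than every closer of $\pi$, $1$ is an opener and $m$ is a closer (fixed points may occur anywhere strictly between $1$ and $m$). For $\pi\in\mathcal{P}^{OC}_m$ let $c_1<c_2<\dots<c_r$ be the closers of $\pi$, let $\rho_\pi(c_i)=c_{r+1-i}$ and $\rho_\pi(x)=x$ for every other $x\in[m]$, and define $\Phi(\pi)$ to be the partial matching with arcs $\{(a,\rho_\pi(b)):(a,b)\text{ an arc of }\pi\}$ and the same fixed points as $\pi$. Then $\Phi$ is an involution on $\mathcal{P}^{OC}_m$ and for every $t\ge2$, $$\mathrm{ne}_t(\Phi(\pi))=\mathrm{cr}_t(\pi),\qquad \mathrm{cr}_t(\Phi(\pi))=\mathrm{ne}_t(\pi).$$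
   Context: A partial matching of $[m]=\{1,\dots,m\}$ is a set partition of $[m]$ all of whose blocks have size $1$ or $2$. A block $\{i,j\}$ with $i<j$ is written as the arc $(i,j)$; $i$ is called an opener and $j$ a closer. A singleton block $\{i\}$ is called a fixed point. For $t\ge 2$, a $t$-crossing is a set of $t$ arcs $(i_1,j_1),\dots,(i_t,j_t)$ with $i_1<i_2<\dots<i_t<j_1<j_2<\dots<j_t$, and a $t$-nesting is a set of $t$ arcs with $i_1<i_2<\dots<i_t<j_t<j_{t-1}<\dots<j_1$. For a partial matching $\pi$ and $t\ge2$, $\mathrm{cr}_t(\pi)$ and $\mathrm{ne}_t(\pi)$ denote the number of $t$-crossings and of $t$-nestings of $\pi$. -}

module Defs where

open import Data.Bool using (Bool; T)
import Data.Bool.Properties as Bool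
open import Data.Fin using (Fin; toℕ; opposite; _<_)
open import Data.Fin.Properties using (_≟_; _<?_; any?)
open import Data.Fin.Subset using (Subset; Nonempty; _∈_; ⁅_⁆; _∪_; ∣_∣)
open import Data.List as List using (List; []; _∷_; length; filter; allFin; cartesianProduct; cartesianProductWith)
import Data.List.Membership.DecPropositional as DecMembership
open import Data.List.Relation.Unary.Any using (index)
open import Data.Nat using (ℕ; zero; suc)
open import Data.Product using (_×_; _,_; ∃; ∃₂; proj₁; proj₂)
open import Data.Sum using (_⊎_)
open import Data.Vec as Vec using (Vec; []; _∷_)
open import Data.Vec.Properties using (≡-dec)
open import Data.Vec.Relation.Unary.Linked using (Linked; linked?)
open import Relation.Binary.PropositionalEquality using (_≡_)
open import Relation.Nullary using (Dec; yes; no; ⌊_⌋)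
open import Relation.Nullary.Decidable using (T?; _×-dec_; _⊎-dec_)

private
  variable
    m : ℕ

-- The element x of [m] is the y : Fin m with label y ≡ x.
label : Fin m → ℕ
label x = suc (toℕ x)

-- Sets of subsets of [m], given by their characteristic function; two of them
-- are equal as sets when their characteristic functions agree pointwise.
SetSystem : ℕ → Set
SetSystem m = Subset m → Bool

infix 4 _∈ˢ_
_∈ˢ_ : Subset m → SetSystem m → Set
B ∈ˢ π = T (π B)

record IsSetPartition (π : SetSystem m) : Set where
  field
    nonempty : ∀ B → B ∈ˢ π → Nonempty B
    covering : ∀ x → ∃ λ B → B ∈ˢ π × x ∈ B
    disjoint : ∀ B C → B ∈ˢ π → C ∈ˢ π → ∀ x → x ∈ B → x ∈ C → B ≡ C

record IsPartialMatching (π : SetSystem m) : Set where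
  field
    isSetPartition : IsSetPartition π
    blockSize      : ∀ B → B ∈ˢ π → ∣ B ∣ ≡ 1 ⊎ ∣ B ∣ ≡ 2

Arc : SetSystem m → Fin m → Fin m → Set
Arc π i j = i < j × ⁅ i ⁆ ∪ ⁅ j ⁆ ∈ˢ π

FixedPoint : SetSystem m → Fin m → Set
FixedPoint π x = ⁅ x ⁆ ∈ˢ π

Opener : SetSystem m → Fin m → Set
Opener π i = ∃ λ j → Arc π i j

Closer : SetSystem m → Fin m → Set
Closer π j = ∃ λ i → Arc π i j

arc? : ∀ (π : SetSystem m) i j → Dec (Arc π i j)
arc? π i j = (i <? j) ×-dec T? (π (⁅ i ⁆ ∪ ⁅ j ⁆))

fixedPoint? : ∀ (π : SetSystem m) x → Dec (FixedPoint π x)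
fixedPoint? π x = T? (π ⁅ x ⁆)

closer? : ∀ (π : SetSystem m) j → Dec (Closer π j)
closer? π j = any? λ i → arc? π i j

arcs : SetSystem m → List (Fin m × Fin m)
arcs {m} π = filter (λ (i , j) → arc? π i j) (cartesianProduct (allFin m) (allFin m))

tuples : ∀ {A : Set} → List A → (t : ℕ) → List (Vec A t)
tuples xs zero    = [] ∷ []
tuples xs (suc t) = cartesianProductWith _∷_ xs (tuples xs t)

-- A set of t arcs forming a t-crossing (t-nesting) is represented by its unique
-- listing (i₁ , j₁) , … , (iₜ , jₜ) with i₁ < … < iₜ.

-- i₁ < … < iₜ < j₁ < … < jₜ
Crossing : ∀ {t} → Vec (Fin m × Fin m) t → Set
Crossing v = Linked _<_ (Vec.map proj₁ v Vec.++ Vec.map proj₂ v)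

-- i₁ < … < iₜ < jₜ < … < j₁
Nesting : ∀ {t} → Vec (Fin m × Fin m) t → Set
Nesting v = Linked _<_ (Vec.map proj₁ v Vec.++ Vec.reverse (Vec.map proj₂ v))

crossing? : ∀ {t} (v : Vec (Fin m × Fin m) t) → Dec (Crossing v)
crossing? v = linked? _<?_ _

nesting? : ∀ {t} (v : Vec (Fin m × Fin m) t) → Dec (Nesting v)
nesting? v = linked? _<?_ _

cr : ℕ → SetSystem m → ℕ
cr t π = length (filter crossing? (tuples (arcs π) t))

ne : ℕ → SetSystem m → ℕ
ne t π = length (filter nesting? (tuples (arcs π) t))

record POC (π : SetSystem m) : Set where
  field
    isPartialMatching : IsPartialMatching π
    hasArc            : ∃₂ λ i j → Arc π i j
    openers<closers   : ∀ i j → Opener π i → Closer π j → i < j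
    firstIsOpener     : ∃ λ x → label x ≡ 1 × Opener π x
    lastIsCloser      : ∃ λ x → label x ≡ m × Closer π x

-- allFin m is increasing, so this is the list c₁ < … < cᵣ.
closers : SetSystem m → List (Fin m)
closers {m} π = filter (closer? π) (allFin m)

-- Positions are counted from 0, so opposite realises i ↦ r + 1 - i.
mirror : List (Fin m) → Fin m → Fin m
mirror cs x with DecMembership._∈?_ _≟_ x cs
... | yes x∈cs = List.lookup cs (opposite (index x∈cs))
... | no  _    = x

ρ : SetSystem m → Fin m → Fin m
ρ π = mirror (closers π)

ΦBlock : SetSystem m → Subset m → Set
ΦBlock π B = (∃ λ x → FixedPoint π x × B ≡ ⁅ x ⁆)
           ⊎ (∃₂ λ a b → Arc π a b × B ≡ ⁅ a ⁆ ∪ ⁅ ρ π b ⁆)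

ΦBlock? : ∀ (π : SetSystem m) B → Dec (ΦBlock π B)
ΦBlock? π B =
        any? (λ x → fixedPoint? π x ×-dec ≡-dec Bool._≟_ B ⁅ x ⁆)
  ⊎-dec any? (λ a → any? λ b → arc? π a b ×-dec ≡-dec Bool._≟_ B (⁅ a ⁆ ∪ ⁅ ρ π b ⁆))

Φ : SetSystem m → SetSystem m
Φ π B = ⌊ ΦBlock? π B ⌋

{-# OPTIONS --safe #-}

-- Since every opener precedes every closer, a set of arcs listed by increasing
-- openers is a crossing (nesting) exactly when its closers are increasing
-- (decreasing).  The map ρ is an order-reversing involution of the closers, so
-- applying it to the closing endpoints exchanges the two conditions, and it does
-- not change which points are openers, closers or fixed points.
module Submission where

open import Defs
open import Data.Bool using (Bool; T)
open import Data.Bool.Properties using (T-≡; ⇔→≡)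
open import Data.Fin using (Fin; zero; suc; opposite; _<_)
open import Data.Fin.Properties using (_≟_; <-cmp; <-trans; <-irrefl; <-asym; <⇒≢; toℕ<n; opposite-prop; opposite-involutive; injective⇒≤)
open import Data.Fin.Subset using (Subset; inside; outside; ⊥; ⁅_⁆; _∪_; ∣_∣; _∈_)
open import Data.Fin.Subset.Properties using (x∈⁅x⁆; x∈⁅y⁆⇒x≡y; ∣⁅x⁆∣≡1; ∪-identityˡ; x∈p∪q⁻; x∈p∪q⁺)
open import Data.List as List using (List; []; _∷_; _++_; length; filter; allFin; cartesianProduct; reverse)
import Data.List.Membership.DecPropositional as DecMembership
open import Data.List.Membership.Propositional renaming (_∈_ to _∈ₗ_; _∉_ to _∉ₗ_)
open import Data.List.Membership.Propositional.Properties using (∈-lookup; ∈-filter⁺; ∈-filter⁻; ∈-allFin; ∈-cartesianProduct⁺; ∈-cartesianProductWith⁺; ∈-cartesianProductWith⁻)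
open import Data.List.Membership.Setoid.Properties using (index-injective)
open import Data.List.Properties using (filter-≐; reverse-involutive; unfold-reverse)
open import Data.List.Relation.Binary.Permutation.Propositional using (↭-sym)
open import Data.List.Relation.Binary.Permutation.Propositional.Properties using (All-resp-↭; ↭-reverse)
open import Data.List.Relation.Unary.All as All using (All; []; _∷_)
import Data.List.Relation.Unary.All.Properties as All
open import Data.List.Relation.Unary.AllPairs as AllPairs using (AllPairs; []; _∷_)
import Data.List.Relation.Unary.AllPairs.Properties as AllPairs
open import Data.List.Relation.Unary.Any using (here; index)
open import Data.List.Relation.Unary.Any.Properties using (lookup-index)
open import Data.List.Relation.Unary.Linked using (Linked; []; [-]; _∷_)
open import Data.List.Relation.Unary.Linked.Properties using (AllPairs⇒Linked; Linked⇒AllPairs)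
open import Data.List.Relation.Unary.Unique.Propositional using (Unique)
import Data.List.Relation.Unary.Unique.Propositional.Properties as Unique
open import Data.Nat as ℕ using (ℕ; zero; suc; _≤_; s<s⁻¹; z<s; s<s)
open import Data.Nat.Properties using (∸-monoʳ-<; ≤-antisym; suc-injective)
open import Data.Product using (_×_; _,_; ∃; ∃₂; proj₁; proj₂; map₂)
open import Data.Sum using (_⊎_; inj₁; inj₂)
open import Data.Vec as Vec using (Vec; []; _∷_; toList)
open import Data.Vec.Properties using (∷-injective; map-id; map-cong; map-∘; toList-++; toList-map; toList-reverse)
import Data.Vec.Relation.Unary.All as VecAll
import Data.Vec.Relation.Unary.All.Properties as VecAll
import Data.Vec.Relation.Unary.Linked as VecLinked
open import Function using (_∘_; flip; id; mk⇔; Equivalence)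
open import Level using (Level)
open import Relation.Binary using (Rel; tri<; tri≈; tri>)
open import Relation.Binary.PropositionalEquality using (_≡_; _≢_; _≗_; refl; sym; trans; cong; cong₂; subst; subst₂; setoid)
open import Relation.Nullary using (¬_; yes; no; contradiction)
open import Relation.Nullary.Decidable using (toWitness; fromWitness)
open import Relation.Unary using (Pred)

private
  variable
    m n t : ℕ
    p r s : Level
    A B : Set

-- Turns a logical equivalence of block conditions into pointwise equality of set systems.
T-extensional : {b c : Bool} → (T b → T c) → (T c → T b) → b ≡ c
T-extensional f g = ⇔→≡ (mk⇔ (to T-≡ ∘ f ∘ from T-≡) (to T-≡ ∘ g ∘ from T-≡))
  where open Equivalence

-- Lists

module _ {R : Rel A r} where

  AllPairs-lookup : ∀ {xs i j} → AllPairs R xs → i < j → R (List.lookup xs i) (List.lookup xs j)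
  AllPairs-lookup {x ∷ xs} {zero}  {suc j} (px ∷ _)  _   = All.lookup px (∈-lookup j)
  AllPairs-lookup {x ∷ xs} {suc i} {suc j} (_ ∷ pxs) i<j = AllPairs-lookup pxs (s<s⁻¹ i<j)

  AllPairs-++⁻ : ∀ xs {ys} → AllPairs R (xs ++ ys) → AllPairs R xs × AllPairs R ys
  AllPairs-++⁻ []       pys      = [] , pys
  AllPairs-++⁻ (x ∷ xs) (px ∷ p) with pxs , pys ← AllPairs-++⁻ xs p = All.++⁻ˡ xs px ∷ pxs , pys

  AllPairs-reverse⁺ : ∀ {xs} → AllPairs R xs → AllPairs (flip R) (reverse xs)
  AllPairs-reverse⁺ {[]}     []         = []
  AllPairs-reverse⁺ {x ∷ xs} (px ∷ pxs) = subst (AllPairs _) (sym (unfold-reverse x xs))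
    (AllPairs.++⁺ (AllPairs-reverse⁺ pxs) ([] ∷ [])
      (All-resp-↭ (↭-sym (↭-reverse xs)) (All.map (λ r → r ∷ []) px)))

  -- The side condition `P` is carried along because `ρ` reverses the order only among closers, not
  -- on all of `Fin m`.
  AllPairs-mapWithAll : ∀ {S : Rel A s} {P : Pred A p} → (∀ {x y} → P x → P y → R x y → S x y) →
                        ∀ {xs} → All P xs → AllPairs R xs → AllPairs S xs
  AllPairs-mapWithAll f []       []         = []
  AllPairs-mapWithAll f (p ∷ ps) (px ∷ pxs) =
    All.zipWith (λ (q , r) → f p q r) (ps , px) ∷ AllPairs-mapWithAll f ps pxs

  -- `Crossing` and `Nesting` are stated on vectors, while the arguments about appending and
  -- reversing run on lists; this and its converse are the bridge.
  Linked-toList⁺ : ∀ {v : Vec A n} → VecLinked.Linked R v → Linked R (toList v)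
  Linked-toList⁺ VecLinked.[]                       = []
  Linked-toList⁺ VecLinked.[-]                      = [-]
  Linked-toList⁺ {v = _ ∷ _ ∷ _} (r VecLinked.∷ rs) = r ∷ Linked-toList⁺ rs

  Linked-toList⁻ : ∀ {v : Vec A n} → Linked R (toList v) → VecLinked.Linked R v
  Linked-toList⁻ {v = []}        []       = VecLinked.[]
  Linked-toList⁻ {v = _ ∷ []}    [-]      = VecLinked.[-]
  Linked-toList⁻ {v = _ ∷ _ ∷ _} (r ∷ rs) = r VecLinked.∷ Linked-toList⁻ rs

-- Of two different positions one comes first, so their entries are related by `R` and hence
-- distinct. Serves both for `Unique` lists and for strictly increasing ones.
AllPairs-lookup-injective : ∀ {R : Rel A r} → (∀ {x y} → R x y → x ≢ y) → ∀ {xs} → AllPairs R xs →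
                            ∀ {i j} → List.lookup xs i ≡ List.lookup xs j → i ≡ j
AllPairs-lookup-injective R⇒≢ pxs {i} {j} eq with <-cmp i j
... | tri< i<j _ _ = contradiction eq (R⇒≢ (AllPairs-lookup pxs i<j))
... | tri≈ _ i≡j _ = i≡j
... | tri> _ _ j<i = contradiction (sym eq) (R⇒≢ (AllPairs-lookup pxs j<i))

-- Pigeonhole: sending a position of `xs` to the position of its image in `ys` is an injection
-- between finite sets. This is how crossings and nestings get counted against each other.
Unique-length-≤ : ∀ {xs : List A} {ys : List B} (f : A → B) → (∀ {x y} → f x ≡ f y → x ≡ y) →
                  Unique xs → (∀ {x} → x ∈ₗ xs → f x ∈ₗ ys) → length xs ≤ length ys
Unique-length-≤ f f-inj xs! f∈ = injective⇒≤ {f = λ i → index (f∈ (∈-lookup i))} λ eq →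
  AllPairs-lookup-injective id xs! (f-inj (index-injective (setoid _) _ _ eq))

tuples-unique : ∀ {xs : List A} → Unique xs → ∀ t → Unique (tuples xs t)
tuples-unique xs! zero    = [] ∷ []
tuples-unique xs! (suc t) = Unique.cartesianProductWith⁺ _∷_ ∷-injective xs! (tuples-unique xs! t)

∈-tuples⁺ : ∀ {xs : List A} {v : Vec A t} → VecAll.All (_∈ₗ xs) v → v ∈ₗ tuples xs t
∈-tuples⁺ VecAll.[]       = here refl
∈-tuples⁺ (p VecAll.∷ ps) = ∈-cartesianProductWith⁺ _∷_ p (∈-tuples⁺ ps)

∈-tuples⁻ : ∀ {xs : List A} {v : Vec A t} → v ∈ₗ tuples xs t → VecAll.All (_∈ₗ xs) v
∈-tuples⁻ {v = []} _ = VecAll.[]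
∈-tuples⁻ {t = suc t} {xs = xs} v∈ with _ , _ , x∈ , w∈ , refl ← ∈-cartesianProductWith⁻ _∷_ xs (tuples xs t) v∈
  = x∈ VecAll.∷ ∈-tuples⁻ w∈

-- One- and two-element subsets

∈-pair⁻ : ∀ {x i j : Fin n} → x ∈ ⁅ i ⁆ ∪ ⁅ j ⁆ → x ≡ i ⊎ x ≡ j
∈-pair⁻ {i = i} {j} x∈ with x∈p∪q⁻ ⁅ i ⁆ ⁅ j ⁆ x∈
... | inj₁ p = inj₁ (x∈⁅y⁆⇒x≡y i p)
... | inj₂ p = inj₂ (x∈⁅y⁆⇒x≡y j p)

∈-pairˡ : ∀ (i j : Fin n) → i ∈ ⁅ i ⁆ ∪ ⁅ j ⁆
∈-pairˡ i j = x∈p∪q⁺ (inj₁ (x∈⁅x⁆ i))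

∈-pairʳ : ∀ (i j : Fin n) → j ∈ ⁅ i ⁆ ∪ ⁅ j ⁆
∈-pairʳ i j = x∈p∪q⁺ {p = ⁅ i ⁆} (inj₂ (x∈⁅x⁆ j))

singleton-injective : ∀ {x y : Fin n} → ⁅ x ⁆ ≡ ⁅ y ⁆ → x ≡ y
singleton-injective {x = x} {y} eq = x∈⁅y⁆⇒x≡y y (subst (x ∈_) eq (x∈⁅x⁆ x))

pair≢singleton : ∀ {i j x : Fin n} → i < j → ⁅ i ⁆ ∪ ⁅ j ⁆ ≢ ⁅ x ⁆
pair≢singleton {i = i} {j} {x} i<j eq = <⇒≢ i<j (trans
  (x∈⁅y⁆⇒x≡y x (subst (i ∈_) eq (∈-pairˡ i j)))
  (sym (x∈⁅y⁆⇒x≡y x (subst (j ∈_) eq (∈-pairʳ i j)))))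

-- A set forgets the order of its elements; listing the smaller one first rules out the swapped
-- identification.
pair-injective : ∀ {i j k l : Fin n} → i < j → k < l → ⁅ i ⁆ ∪ ⁅ j ⁆ ≡ ⁅ k ⁆ ∪ ⁅ l ⁆ → i ≡ k × j ≡ l
pair-injective {i = i} {j} {k} {l} i<j k<l eq
  with ∈-pair⁻ {i = k} {l} (subst (i ∈_) eq (∈-pairˡ i j)) | ∈-pair⁻ {i = k} {l} (subst (j ∈_) eq (∈-pairʳ i j))
... | inj₁ i≡k  | inj₂ j≡l  = i≡k , j≡l
... | inj₁ refl | inj₁ refl = contradiction i<j (<-irrefl refl)
... | inj₂ refl | inj₂ refl = contradiction i<j (<-irrefl refl)
... | inj₂ refl | inj₁ refl = contradiction i<j (<-asym k<l)

∣p∣≡0⇒p≡⊥ : ∀ (p : Subset n) → ∣ p ∣ ≡ 0 → p ≡ ⊥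
∣p∣≡0⇒p≡⊥ []            _  = refl
∣p∣≡0⇒p≡⊥ (outside ∷ p) eq = cong (outside ∷_) (∣p∣≡0⇒p≡⊥ p eq)

∣p∣≡1⇒singleton : ∀ (p : Subset n) → ∣ p ∣ ≡ 1 → ∃ λ x → p ≡ ⁅ x ⁆
∣p∣≡1⇒singleton (inside  ∷ p) eq = zero , cong (inside ∷_) (∣p∣≡0⇒p≡⊥ p (suc-injective eq))
∣p∣≡1⇒singleton (outside ∷ p) eq with x , refl ← ∣p∣≡1⇒singleton p eq = suc x , refl

∣p∣≡2⇒pair : ∀ (p : Subset n) → ∣ p ∣ ≡ 2 → ∃₂ λ i j → i < j × p ≡ ⁅ i ⁆ ∪ ⁅ j ⁆
∣p∣≡2⇒pair (inside  ∷ p) eq with x , refl ← ∣p∣≡1⇒singleton p (suc-injective eq) =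
  -- The tail of `⁅ zero ⁆ ∪ ⁅ suc x ⁆` is `⊥ ∪ ⁅ x ⁆`, which still has to be simplified.
  zero , suc x , z<s , cong (inside ∷_) (sym (∪-identityˡ _))
∣p∣≡2⇒pair (outside ∷ p) eq with i , j , i<j , refl ← ∣p∣≡2⇒pair p eq = suc i , suc j , s<s i<j , refl

∣pair∣≡2 : ∀ {i j : Fin n} → i < j → ∣ ⁅ i ⁆ ∪ ⁅ j ⁆ ∣ ≡ 2
∣pair∣≡2 {i = zero}  {suc j} _   = cong suc (trans (cong ∣_∣ (∪-identityˡ ⁅ j ⁆)) (∣⁅x⁆∣≡1 j))
∣pair∣≡2 {i = suc i} {suc j} i<j = ∣pair∣≡2 (s<s⁻¹ i<j)

-- Mirroring an increasing list

opposite-antitone : ∀ {i j : Fin n} → i < j → opposite j < opposite i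
-- `opposite i` has value `n ∸ suc i`; the bound on `j` prevents truncation, so the inequality stays
-- strict.
opposite-antitone {i = i} {j} i<j = subst₂ ℕ._<_ (sym (opposite-prop j)) (sym (opposite-prop i))
  (∸-monoʳ-< (s<s i<j) (toℕ<n j))

mirror-∉ : ∀ {cs : List (Fin m)} {x} → x ∉ₗ cs → mirror cs x ≡ x
mirror-∉ {cs = cs} {x} x∉ with DecMembership._∈?_ _≟_ x cs
... | yes x∈ = contradiction x∈ x∉
... | no _   = refl

module _ {cs : List (Fin m)} (cs↗ : AllPairs _<_ cs) where

  -- The membership test returns some position of the entry; since a strictly increasing list has no
  -- repetitions, that position can only be `i`.
  mirror-lookup : ∀ i → mirror cs (List.lookup cs i) ≡ List.lookup cs (opposite i)
  mirror-lookup i with DecMembership._∈?_ _≟_ (List.lookup cs i) cs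
  ... | yes p = cong (List.lookup cs ∘ opposite) (AllPairs-lookup-injective <⇒≢ cs↗ (sym (lookup-index p)))
  ... | no ∉  = contradiction (∈-lookup i) ∉

  mirror-∈ : ∀ {x} → x ∈ₗ cs → mirror cs x ∈ₗ cs
  mirror-∈ x∈ rewrite lookup-index x∈ | mirror-lookup (index x∈) = ∈-lookup (opposite (index x∈))

  mirror-involutive : ∀ x → mirror cs (mirror cs x) ≡ x
  mirror-involutive x with DecMembership._∈?_ _≟_ x cs
  ... | no x∉  = mirror-∉ x∉
  ... | yes x∈ = trans (mirror-lookup (opposite (index x∈)))
    (trans (cong (List.lookup cs) (opposite-involutive (index x∈))) (sym (lookup-index x∈)))

  mirror-antitone : ∀ {x y} → x ∈ₗ cs → y ∈ₗ cs → x < y → mirror cs y < mirror cs x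
  -- Both points are replaced by entries of `cs`, so that comparing them reduces to comparing
  -- positions, which `opposite` reverses.
  mirror-antitone x∈ y∈ x<y with index x∈ | lookup-index x∈ | index y∈ | lookup-index y∈
  ... | i | refl | j | refl with <-cmp i j
  ... | tri< i<j _ _  = subst₂ _<_ (sym (mirror-lookup j)) (sym (mirror-lookup i))
                          (AllPairs-lookup cs↗ (opposite-antitone i<j))
  ... | tri≈ _ refl _ = contradiction x<y (<-irrefl refl)
  ... | tri> _ _ j<i  = contradiction x<y (<-asym (AllPairs-lookup cs↗ j<i))

-- Set systems

Arc-cong : ∀ {π σ : SetSystem m} → π ≗ σ → ∀ {i j} → Arc π i j → Arc σ i j
Arc-cong π≗σ = map₂ (subst T (π≗σ _))

-- Filtering by equivalent predicates yields the very same list, so pointwise equality of systems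
-- becomes an equality that `cr` and `ne` respect by congruence.
arcs-cong : ∀ {π σ : SetSystem m} → π ≗ σ → arcs π ≡ arcs σ
arcs-cong {m} {π} {σ} π≗σ = filter-≐ (λ (i , j) → arc? π i j) (λ (i , j) → arc? σ i j)
  (Arc-cong π≗σ , Arc-cong (sym ∘ π≗σ)) (cartesianProduct (allFin m) (allFin m))

cr-cong : ∀ {π σ : SetSystem m} → π ≗ σ → cr t π ≡ cr t σ
cr-cong {t = t} π≗σ = cong (λ as → length (filter crossing? (tuples as t))) (arcs-cong π≗σ)

ne-cong : ∀ {π σ : SetSystem m} → π ≗ σ → ne t π ≡ ne t σ
ne-cong {t = t} π≗σ = cong (λ as → length (filter nesting? (tuples as t))) (arcs-cong π≗σ)

-- `ρ` depends on the system only through its closers. The hypotheses ask for no more than that, so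
-- the lemma also compares `Φ π` with `π`.
ρ-cong : ∀ {π σ : SetSystem m} → (∀ {j} → Closer π j → Closer σ j) → (∀ {j} → Closer σ j → Closer π j) →
         ∀ x → ρ π x ≡ ρ σ x
ρ-cong {m} {π} {σ} f g x = cong (λ cs → mirror cs x) (filter-≐ (closer? π) (closer? σ) (f , g) (allFin m))

Φ⁺ : ∀ {π : SetSystem m} {B} → ΦBlock π B → B ∈ˢ Φ π
Φ⁺ {π = π} {B} = fromWitness {a? = ΦBlock? π B}

Φ⁻ : ∀ {π : SetSystem m} {B} → B ∈ˢ Φ π → ΦBlock π B
Φ⁻ {π = π} {B} = toWitness {a? = ΦBlock? π B}

ΦBlock-cong : ∀ {π σ : SetSystem m} → π ≗ σ → ∀ {B} → ΦBlock π B → ΦBlock σ B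
ΦBlock-cong π≗σ (inj₁ (x , fp , eq)) = inj₁ (x , subst T (π≗σ _) fp , eq)
ΦBlock-cong {π = π} {σ} π≗σ (inj₂ (a , b , ab , refl)) = inj₂ (a , b , Arc-cong π≗σ ab ,
  cong (λ c → ⁅ a ⁆ ∪ ⁅ c ⁆)
    (ρ-cong {π = π} {σ} (map₂ (Arc-cong π≗σ)) (map₂ (Arc-cong (sym ∘ π≗σ))) b))

Φ-cong : ∀ {π σ : SetSystem m} → π ≗ σ → Φ π ≗ Φ σ
Φ-cong {π = π} {σ} π≗σ B = T-extensional
  (Φ⁺ {π = σ} ∘ ΦBlock-cong π≗σ ∘ Φ⁻ {π = π})
  (Φ⁺ {π = π} ∘ ΦBlock-cong (sym ∘ π≗σ) ∘ Φ⁻ {π = σ})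

-- Closers, their reversal, and the list of arcs

closers-increasing : ∀ (π : SetSystem m) → AllPairs _<_ (closers π)
closers-increasing π = AllPairs.filter⁺ (closer? π) (AllPairs.tabulate⁺-< id)

∈-closers⁺ : ∀ {π : SetSystem m} {x} → Closer π x → x ∈ₗ closers π
∈-closers⁺ {π = π} = ∈-filter⁺ (closer? π) (∈-allFin _)

∈-closers⁻ : ∀ {π : SetSystem m} {x} → x ∈ₗ closers π → Closer π x
∈-closers⁻ {m} {π} x∈ = proj₂ (∈-filter⁻ (closer? π) {xs = allFin m} x∈)

ρ-closer : ∀ {π : SetSystem m} {x} → Closer π x → Closer π (ρ π x)
ρ-closer {π = π} = ∈-closers⁻ {π = π} ∘ mirror-∈ (closers-increasing π) ∘ ∈-closers⁺ {π = π}

ρ-involutive : ∀ (π : SetSystem m) x → ρ π (ρ π x) ≡ x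
ρ-involutive π = mirror-involutive (closers-increasing π)

ρ-antitone : ∀ {π : SetSystem m} {x y} → Closer π x → Closer π y → x < y → ρ π y < ρ π x
ρ-antitone {π = π} cx cy = mirror-antitone (closers-increasing π) (∈-closers⁺ {π = π} cx) (∈-closers⁺ {π = π} cy)

∈-arcs⁺ : ∀ {π : SetSystem m} {i j} → Arc π i j → (i , j) ∈ₗ arcs π
∈-arcs⁺ {π = π} = ∈-filter⁺ (λ (i , j) → arc? π i j) (∈-cartesianProduct⁺ (∈-allFin _) (∈-allFin _))

∈-arcs⁻ : ∀ {π : SetSystem m} {i j} → (i , j) ∈ₗ arcs π → Arc π i j
∈-arcs⁻ {m} {π} e = proj₂ (∈-filter⁻ (λ (i , j) → arc? π i j) {xs = cartesianProduct (allFin m) (allFin m)} e)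

arcs-unique : ∀ (π : SetSystem m) → Unique (arcs π)
arcs-unique {m} π = Unique.filter⁺ (λ (i , j) → arc? π i j) (Unique.cartesianProduct⁺ (Unique.allFin⁺ m) (Unique.allFin⁺ m))

-- Blocks of a partial matching

module PartialMatching {π : SetSystem m} (M : IsPartialMatching π) where
  open IsPartialMatching M
  open IsSetPartition isSetPartition

  block-cases : ∀ {B} → B ∈ˢ π → (∃ λ x → FixedPoint π x × B ≡ ⁅ x ⁆)
                                ⊎ (∃₂ λ i j → Arc π i j × B ≡ ⁅ i ⁆ ∪ ⁅ j ⁆)
  block-cases {B} B∈ with blockSize B B∈
  ... | inj₁ eq with x , refl ← ∣p∣≡1⇒singleton B eq = inj₁ (x , B∈ , refl)
  ... | inj₂ eq with i , j , i<j , refl ← ∣p∣≡2⇒pair B eq = inj₂ (i , j , (i<j , B∈) , refl)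

  -- A shared point forces the two blocks to coincide, and a block determines its ordered endpoints.
  arcs-disjoint : ∀ {i j k l x} → Arc π i j → Arc π k l → x ∈ ⁅ i ⁆ ∪ ⁅ j ⁆ → x ∈ ⁅ k ⁆ ∪ ⁅ l ⁆ → i ≡ k × j ≡ l
  arcs-disjoint (i<j , ij) (k<l , kl) x∈ x∈′ = pair-injective i<j k<l (disjoint _ _ ij kl _ x∈ x∈′)

  closer-unique : ∀ {i j l} → Arc π i j → Arc π i l → j ≡ l
  closer-unique ij il = proj₂ (arcs-disjoint ij il (∈-pairˡ _ _) (∈-pairˡ _ _))

  opener-unique : ∀ {i k j} → Arc π i j → Arc π k j → i ≡ k
  opener-unique {i} {k} ij kj = proj₁ (arcs-disjoint ij kj (∈-pairʳ i _) (∈-pairʳ k _))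

  fixedPoint∉arc : ∀ {i j x} → FixedPoint π x → Arc π i j → ¬ x ∈ ⁅ i ⁆ ∪ ⁅ j ⁆
  fixedPoint∉arc fp (i<j , ij) x∈ = pair≢singleton i<j (disjoint _ _ ij fp _ x∈ (x∈⁅x⁆ _))

  fixedPoint≢opener : ∀ {x} → FixedPoint π x → ¬ Opener π x
  fixedPoint≢opener fp (_ , a) = fixedPoint∉arc fp a (∈-pairˡ _ _)

  fixedPoint≢closer : ∀ {x} → FixedPoint π x → ¬ Closer π x
  fixedPoint≢closer fp (i , a) = fixedPoint∉arc fp a (∈-pairʳ i _)

-- The exchange map on matchings whose openers precede their closers

module Exchange {π : SetSystem m} (P : POC π) where
  open POC P
  open IsPartialMatching isPartialMatching
  open IsSetPartition isSetPartition
  open PartialMatching isPartialMatching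

  -- `ρ π b` is again a closer, hence larger than every opener; so a moved arc keeps its
  -- orientation.
  opener<ρcloser : ∀ {a b} → Arc π a b → a < ρ π b
  opener<ρcloser ab = openers<closers _ _ (_ , ab) (ρ-closer {π = π} (_ , ab))

  ρ-injective : ∀ {x y} → ρ π x ≡ ρ π y → x ≡ y
  ρ-injective {x} {y} eq = trans (sym (ρ-involutive π x)) (trans (cong (ρ π) eq) (ρ-involutive π y))

  Φ-arc⁺ : ∀ {a b} → Arc π a b → Arc (Φ π) a (ρ π b)
  Φ-arc⁺ ab = opener<ρcloser ab , Φ⁺ {π = π} (inj₂ (_ , _ , ab , refl))

  Φ-arc⁻ : ∀ {a c} → Arc (Φ π) a c → Arc π a (ρ π c)
  Φ-arc⁻ (a<c , ac) with Φ⁻ {π = π} ac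
  ... | inj₁ (x , _ , eq) = contradiction eq (pair≢singleton a<c)
  -- Both pairs have their smaller element first, so `c` is `ρ π b` and a second application of `ρ`
  -- recovers `b`.
  ... | inj₂ (a′ , b , ab , eq) with refl , refl ← pair-injective a<c (opener<ρcloser ab) eq =
    subst (Arc π a′) (sym (ρ-involutive π b)) ab

  Φ-fixedPoint⁺ : ∀ {x} → FixedPoint π x → FixedPoint (Φ π) x
  Φ-fixedPoint⁺ fp = Φ⁺ {π = π} (inj₁ (_ , fp , refl))

  Φ-fixedPoint⁻ : ∀ {x} → FixedPoint (Φ π) x → FixedPoint π x
  Φ-fixedPoint⁻ fp with Φ⁻ {π = π} fp
  ... | inj₁ (y , fy , eq) rewrite singleton-injective eq = fy
  ... | inj₂ (a , b , ab , eq) = contradiction (sym eq) (pair≢singleton (opener<ρcloser ab))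

  Φ-opener⁺ : ∀ {x} → Opener π x → Opener (Φ π) x
  Φ-opener⁺ (_ , a) = _ , Φ-arc⁺ a

  Φ-opener⁻ : ∀ {x} → Opener (Φ π) x → Opener π x
  Φ-opener⁻ (_ , a) = _ , Φ-arc⁻ a

  -- The arc of `π` ending at `ρ π x` is moved to one ending at `ρ π (ρ π x)`, which is `x`.
  Φ-closer⁺ : ∀ {x} → Closer π x → Closer (Φ π) x
  Φ-closer⁺ {x} c with i , a ← ρ-closer {π = π} c = i , subst (Arc (Φ π) i) (ρ-involutive π x) (Φ-arc⁺ a)

  Φ-closer⁻ : ∀ {x} → Closer (Φ π) x → Closer π x
  Φ-closer⁻ {x} (_ , a) = subst (Closer π) (ρ-involutive π x) (ρ-closer {π = π} (_ , Φ-arc⁻ a))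

  Φ-POC : POC (Φ π)
  Φ-POC = record
    { isPartialMatching = record
      { isSetPartition = record
        { nonempty = λ B → nonempty′ ∘ Φ⁻ {π = π}
        ; covering = covering′
        ; disjoint = λ B C B∈ C∈ x x∈B x∈C → disjoint′ (Φ⁻ {π = π} B∈) (Φ⁻ {π = π} C∈) x∈B x∈C
        }
      ; blockSize = λ B → blockSize′ ∘ Φ⁻ {π = π}
      }
    ; hasArc          = let i , _ , a = hasArc in i , _ , Φ-arc⁺ a
    ; openers<closers = λ i j o c → openers<closers i j (Φ-opener⁻ o) (Φ-closer⁻ c)
    ; firstIsOpener   = map₂ (map₂ Φ-opener⁺) firstIsOpener
    ; lastIsCloser    = map₂ (map₂ Φ-closer⁺) lastIsCloser
    }
    where
    nonempty′ : ∀ {B} → ΦBlock π B → ∃ (_∈ B)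
    nonempty′ (inj₁ (x , _ , refl))     = x , x∈⁅x⁆ x
    nonempty′ (inj₂ (a , b , _ , refl)) = a , ∈-pairˡ _ _

    blockSize′ : ∀ {B} → ΦBlock π B → ∣ B ∣ ≡ 1 ⊎ ∣ B ∣ ≡ 2
    blockSize′ (inj₁ (x , _ , refl))      = inj₁ (∣⁅x⁆∣≡1 x)
    blockSize′ (inj₂ (a , b , ab , refl)) = inj₂ (∣pair∣≡2 (opener<ρcloser ab))

    covering′ : ∀ x → ∃ λ B → B ∈ˢ Φ π × x ∈ B
    covering′ x with B , B∈ , x∈ ← covering x | block-cases B∈
    ... | inj₁ (y , fy , refl) = _ , Φ-fixedPoint⁺ fy , x∈
    ... | inj₂ (i , j , a , refl) with ∈-pair⁻ {i = i} {j} x∈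
    ...   | inj₁ refl = _ , proj₂ (Φ-arc⁺ a) , ∈-pairˡ _ _
    -- A closer may change partner, so the block covering it is the one with its new opener `k`.
    ...   | inj₂ refl with k , b ← Φ-closer⁺ (i , a) = _ , proj₂ b , ∈-pairʳ k _

    opener≢ρcloser : ∀ {a b c d} → Arc π a b → Arc π c d → a ≢ ρ π d
    opener≢ρcloser ab cd = <⇒≢ (openers<closers _ _ (_ , ab) (ρ-closer {π = π} (_ , cd)))

    fixedPoint∉Φarc : ∀ {x a b} → FixedPoint π x → Arc π a b → ¬ x ∈ ⁅ a ⁆ ∪ ⁅ ρ π b ⁆
    fixedPoint∉Φarc {a = a} {b} fp ab x∈ with ∈-pair⁻ {i = a} {ρ π b} x∈
    ... | inj₁ refl = fixedPoint≢opener fp (_ , ab)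
    ... | inj₂ refl = fixedPoint≢closer fp (ρ-closer {π = π} (_ , ab))

    disjoint′ : ∀ {B C x} → ΦBlock π B → ΦBlock π C → x ∈ B → x ∈ C → B ≡ C
    disjoint′ (inj₁ (y , _ , refl)) (inj₁ (z , _ , refl)) x∈B x∈C =
      cong ⁅_⁆ (trans (sym (x∈⁅y⁆⇒x≡y y x∈B)) (x∈⁅y⁆⇒x≡y z x∈C))
    disjoint′ (inj₁ (y , fy , refl)) (inj₂ (a , b , ab , refl)) x∈B x∈C
      with refl ← x∈⁅y⁆⇒x≡y y x∈B = contradiction x∈C (fixedPoint∉Φarc fy ab)
    disjoint′ (inj₂ (a , b , ab , refl)) (inj₁ (y , fy , refl)) x∈B x∈C
      with refl ← x∈⁅y⁆⇒x≡y y x∈C = contradiction x∈B (fixedPoint∉Φarc fy ab)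
    disjoint′ (inj₂ (a , b , ab , refl)) (inj₂ (c , d , cd , refl)) x∈B x∈C
      with ∈-pair⁻ {i = a} {ρ π b} x∈B | ∈-pair⁻ {i = c} {ρ π d} x∈C
    ... | inj₁ refl | inj₁ refl = cong (λ e → ⁅ a ⁆ ∪ ⁅ ρ π e ⁆) (closer-unique ab cd)
    -- The common point would be both an opener and a closer of `π`.
    ... | inj₁ refl | inj₂ eq   = contradiction eq (opener≢ρcloser ab cd)
    ... | inj₂ eq   | inj₁ refl = contradiction eq (opener≢ρcloser cd ab)
    -- A common closing end pulls back along the injective `ρ` to a common closer of `π`, which has
    -- only one opener.
    ... | inj₂ refl | inj₂ eq   = let b≡d = ρ-injective eq in
      cong₂ (λ e f → ⁅ e ⁆ ∪ ⁅ ρ π f ⁆) (opener-unique (subst (Arc π a) b≡d ab) cd) b≡d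

  -- `Φ` preserves the set of closers, so its second application uses the same reversal and undoes
  -- the first.
  ρ-Φ : ∀ x → ρ (Φ π) x ≡ ρ π x
  ρ-Φ = ρ-cong {π = Φ π} {π} Φ-closer⁻ Φ-closer⁺

  ΦΦ⁻ : ∀ {B} → ΦBlock (Φ π) B → B ∈ˢ π
  ΦΦ⁻ (inj₁ (x , fx , refl))     = Φ-fixedPoint⁻ fx
  ΦΦ⁻ (inj₂ (a , b , ab , refl)) = subst (λ c → ⁅ a ⁆ ∪ ⁅ c ⁆ ∈ˢ π) (sym (ρ-Φ b)) (proj₂ (Φ-arc⁻ ab))

  ΦΦ⁺ : ∀ {B} → B ∈ˢ π → ΦBlock (Φ π) B
  ΦΦ⁺ B∈ with block-cases B∈
  ... | inj₁ (x , fx , eq) = inj₁ (x , Φ-fixedPoint⁺ fx , eq)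
  ... | inj₂ (a , b , ab , refl) = inj₂ (a , ρ π b , Φ-arc⁺ ab ,
    cong (λ c → ⁅ a ⁆ ∪ ⁅ c ⁆) (sym (trans (ρ-Φ (ρ π b)) (ρ-involutive π b))))

  Φ-involutive : Φ (Φ π) ≗ π
  Φ-involutive B = T-extensional (ΦΦ⁻ ∘ Φ⁻ {π = Φ π}) (Φ⁺ {π = Φ π} ∘ ΦΦ⁺)

  -- Moving tuples of arcs

  moveArc : Fin m × Fin m → Fin m × Fin m
  moveArc = map₂ (ρ π)

  moveArcs : Vec (Fin m × Fin m) t → Vec (Fin m × Fin m) t
  moveArcs = Vec.map moveArc

  moveArcs-injective : ∀ {v w : Vec (Fin m × Fin m) t} → moveArcs v ≡ moveArcs w → v ≡ w
  moveArcs-injective {v = v} {w} eq = trans (sym (involutive v)) (trans (cong moveArcs eq) (involutive w))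
    where
    involutive : ∀ (u : Vec (Fin m × Fin m) t) → moveArcs (moveArcs u) ≡ u
    involutive u = trans (sym (map-∘ moveArc moveArc u))
      (trans (map-cong (λ (a , b) → cong (a ,_) (ρ-involutive π b)) u) (map-id u))

  moveArcs-∈ : ∀ {v : Vec (Fin m × Fin m) t} → v ∈ₗ tuples (arcs π) t → moveArcs v ∈ₗ tuples (arcs (Φ π)) t
  moveArcs-∈ v∈ = ∈-tuples⁺ (VecAll.map⁺ (VecAll.map (∈-arcs⁺ {π = Φ π} ∘ Φ-arc⁺ ∘ ∈-arcs⁻ {π = π}) (∈-tuples⁻ v∈)))

  -- The junction of the two halves is automatic, as every opener is below every closer; only the
  -- order within each half matters.
  openers↗closers : ∀ {as bs} → All (Opener π) as → All (Closer π) bs →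
                    AllPairs _<_ as → AllPairs _<_ bs → Linked _<_ (as ++ bs)
  openers↗closers os cs as↗ bs↗ = AllPairs⇒Linked
    (AllPairs.++⁺ as↗ bs↗ (All.map (λ o → All.map (λ c → openers<closers _ _ o c) cs) os))

  ρ-closers : ∀ {bs} → All (Closer π) bs → All (Closer π) (List.map (ρ π) bs)
  ρ-closers cs = All.map⁺ (All.map (ρ-closer {π = π}) cs)

  -- `ρ` makes the increasing closers decreasing, and the reversal in the definition of a nesting
  -- makes them increasing again.
  crossing⇒nesting-lists : ∀ {as bs} → All (Opener π) as → All (Closer π) bs →
    Linked _<_ (as ++ bs) → Linked _<_ (as ++ reverse (List.map (ρ π) bs))
  crossing⇒nesting-lists {as} os cs l with as↗ , bs↗ ← AllPairs-++⁻ as (Linked⇒AllPairs <-trans l) =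
    openers↗closers os (All-resp-↭ (↭-sym (↭-reverse _)) (ρ-closers cs)) as↗
      (AllPairs-reverse⁺ (AllPairs.map⁺ (AllPairs-mapWithAll (ρ-antitone {π = π}) cs bs↗)))

  nesting⇒crossing-lists : ∀ {as bs} → All (Opener π) as → All (Closer π) bs →
    Linked _<_ (as ++ reverse bs) → Linked _<_ (as ++ List.map (ρ π) bs)
  nesting⇒crossing-lists {as} {bs} os cs l with as↗ , bs↘ ← AllPairs-++⁻ as (Linked⇒AllPairs <-trans l) =
    -- Reversing `reverse bs` once more shows `bs` decreasing, and `ρ` turns this into increasing.
    openers↗closers os (ρ-closers cs) as↗
      (AllPairs.map⁺ (AllPairs-mapWithAll (flip (ρ-antitone {π = π})) cs
        (subst (AllPairs _) (reverse-involutive bs) (AllPairs-reverse⁺ bs↘))))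

  module _ {v : Vec (Fin m × Fin m) t} (v∈ : v ∈ₗ tuples (arcs π) t) where

    private
      as bs : List (Fin m)
      as = toList (Vec.map proj₁ v)
      bs = toList (Vec.map proj₂ v)

      openers : All (Opener π) as
      openers = VecAll.toList⁺ (VecAll.map⁺ (VecAll.map (λ e → _ , ∈-arcs⁻ {π = π} e) (∈-tuples⁻ v∈)))

      closers′ : All (Closer π) bs
      closers′ = VecAll.toList⁺ (VecAll.map⁺ (VecAll.map (λ e → _ , ∈-arcs⁻ {π = π} e) (∈-tuples⁻ v∈)))

      openers-moved : toList (Vec.map proj₁ (moveArcs v)) ≡ as
      openers-moved = cong toList (sym (map-∘ proj₁ moveArc v))

      closers-moved : toList (Vec.map proj₂ (moveArcs v)) ≡ List.map (ρ π) bs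
      closers-moved = trans (cong toList (trans (sym (map-∘ proj₂ moveArc v)) (map-∘ (ρ π) proj₂ v)))
        (toList-map (ρ π) (Vec.map proj₂ v))

    crossing⇒nesting : Crossing v → Nesting (moveArcs v)
    crossing⇒nesting c = Linked-toList⁻ (subst (Linked _<_)
      (sym (trans (toList-++ (Vec.map proj₁ (moveArcs v)) _)
        (cong₂ _++_ openers-moved (trans (toList-reverse (Vec.map proj₂ (moveArcs v))) (cong reverse closers-moved)))))
      (crossing⇒nesting-lists openers closers′
        (subst (Linked _<_) (toList-++ (Vec.map proj₁ v) _) (Linked-toList⁺ c))))

    nesting⇒crossing : Nesting v → Crossing (moveArcs v)
    nesting⇒crossing c = Linked-toList⁻ (subst (Linked _<_)
      (sym (trans (toList-++ (Vec.map proj₁ (moveArcs v)) _) (cong₂ _++_ openers-moved closers-moved)))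
      (nesting⇒crossing-lists openers closers′
        (subst (Linked _<_)
          (trans (toList-++ (Vec.map proj₁ v) _) (cong (as ++_) (toList-reverse (Vec.map proj₂ v))))
          (Linked-toList⁺ c))))

  -- `moveArcs` injects the `t`-crossings of `π` into the `t`-nestings of `Φ π`. An inequality
  -- suffices here, since the opposite one comes from the companion bound at `Φ π`.
  cr≤ne-Φ : ∀ t → cr t π ≤ ne t (Φ π)
  cr≤ne-Φ t = Unique-length-≤ moveArcs moveArcs-injective
    (Unique.filter⁺ crossing? (tuples-unique (arcs-unique π) t))
    λ v∈ → let v∈t , c = ∈-filter⁻ crossing? {xs = tuples (arcs π) t} v∈ in
      ∈-filter⁺ nesting? (moveArcs-∈ v∈t) (crossing⇒nesting v∈t c)

  ne≤cr-Φ : ∀ t → ne t π ≤ cr t (Φ π)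
  ne≤cr-Φ t = Unique-length-≤ moveArcs moveArcs-injective
    (Unique.filter⁺ nesting? (tuples-unique (arcs-unique π) t))
    λ v∈ → let v∈t , c = ∈-filter⁻ nesting? {xs = tuples (arcs π) t} v∈ in
      ∈-filter⁺ crossing? (moveArcs-∈ v∈t) (nesting⇒crossing v∈t c)

-- The reverse inequalities are cr≤ne-Φ and ne≤cr-Φ at Φ π, because Φ (Φ π) ≗ π.
module _ {π : SetSystem m} (P : POC π) where
  open Exchange P
  private module ΦExchange = Exchange Φ-POC

  ne-Φ : ∀ t → ne t (Φ π) ≡ cr t π
  ne-Φ t = ≤-antisym (subst (ne t (Φ π) ≤_) (cr-cong {t = t} Φ-involutive) (ΦExchange.ne≤cr-Φ t)) (cr≤ne-Φ t)

  cr-Φ : ∀ t → cr t (Φ π) ≡ ne t π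
  cr-Φ t = ≤-antisym (subst (cr t (Φ π) ≤_) (ne-cong {t = t} Φ-involutive) (ΦExchange.cr≤ne-Φ t)) (ne≤cr-Φ t)

mainTheorem3 : ∀ (m : ℕ) → 2 ≤ m →
    (∀ (π σ : SetSystem m) → POC π → POC σ → π ≗ σ → Φ π ≗ Φ σ)
    × (∀ (π : SetSystem m) → POC π →
    POC (Φ π)
    × (Φ (Φ π) ≗ π)
    × (∀ (t : ℕ) → 2 ≤ t → (ne t (Φ π) ≡ cr t π) × (cr t (Φ π) ≡ ne t π)))
mainTheorem3 m _ =
    -- Well-definedness: the same set of blocks may be given by different functions.
    (λ π σ _ _ π≗σ → Φ-cong π≗σ)
  , (λ π P → Exchange.Φ-POC P , Exchange.Φ-involutive P , λ t _ → ne-Φ P t , cr-Φ P t)
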